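{- Let $\ell\ge 2$ be an integer and let $\lambda$ be a partition. Then $\lambda$ is an $\ell$-partition if and only if it satisfies $$(\star)\qquad \nu_\ell\big(h^\lambda_{(a,c)}\big)=\nu_\ell\big(h^\lambda_{(b,c)}\big)\quad\text{for all pairs of boxes }(a,c),(b,c)\text{ in the Young diagram of }\lambda .$$
   Context: $(x,y)$ denotes the box in row $x$ and column $y$ of the Young diagram of a partition (row $j$ has $\lambda_j$ boxes, left-justified, rows numbered from the top). The hook length $h^\lambda_{(a,b)}$ is the number of boxes to the right of and below $(a,b)$ (same row or same column), including $(a,b)$ itself. For $k\in\mathbb Z$, $\nu_\ell(k)=1$ if $\ell\mid k$ and $\nu_\ell(k)=0$ otherwise. A partition is $\ell$-regular if it does not have $\ell$ or more equal nonzero parts. A removable $\ell$-rim hook (for short, $\ell$-rim hook) of $\lambda$ is a connected sequence of $\ell$ boxes of the Young diagram of $\lambda$, containing no $2\times2$ square, whose removal from $\lambda$ leaves the Young diagram of a partition. It is horizontal if all its boxes lie in one row, and non-horizontal otherwise. An $\ell$-partition is an $\ell$-regular partition which has no non-horizontal $\ell$-rim hooks and such that, after removing any number of horizontal $\ell$-rim hooks in any order, the remaining diagram has no non-horizontal $\ell$-rim hooks. -}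

module Defs where

open import Data.Bool using (if_then_else_)
open import Data.Integer using (ℤ; ∣_∣)
open import Data.List using (List; length; lookup; map; concatMap; filter; upTo; allFin)
open import Data.List.Membership.Propositional using (_∈_; _∉_)
open import Data.List.Relation.Binary.Subset.Propositional using (_⊆_)
open import Data.List.Relation.Unary.All using (All)
open import Data.List.Relation.Unary.Linked using (Linked)
open import Data.List.Relation.Unary.Unique.Propositional using (Unique)
open import Data.Fin using (toℕ)
open import Data.Nat using (ℕ; suc; _≤_; _<_; _≥_; _≟_; _≤?_)
open import Data.Nat.Divisibility using (_∣?_)
open import Data.Product using (_×_; _,_; ∃-syntax; proj₁)
open import Data.Sum using (_⊎_)
open import Function.Bundles using (_⇔_)
open import Relation.Binary.Construct.Closure.ReflexiveTransitive using (Star)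
open import Relation.Binary.PropositionalEquality using (_≡_)
open import Relation.Nullary using (¬_; Dec; does)
open import Relation.Nullary.Decidable using (_×-dec_; _⊎-dec_)

record Partition : Set where
  field
    parts    : List ℕ
    weakly-decreasing : Linked _≥_ parts
    positive : All (0 <_) parts

open Partition public

-- (x , y) is the box in row x and column y, both counted from 0, with rows
-- numbered downwards and columns rightwards.
Box : Set
Box = ℕ × ℕ

diagram : Partition → List Box
diagram μ =
  concatMap (λ i → map (toℕ i ,_) (upTo (lookup (parts μ) i)))
            (allFin (length (parts μ)))

InHook : Box → Box → Set
InHook (a , b) (x , y) = (x ≡ a × b ≤ y) ⊎ (y ≡ b × a ≤ x)

inHook? : ∀ s t → Dec (InHook s t)
inHook? (a , b) (x , y) = (x ≟ a ×-dec b ≤? y) ⊎-dec (y ≟ b ×-dec a ≤? x)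

-- The boxes of a diagram are listed without repetition, so this counts them;
-- the corner box s satisfies both disjuncts of InHook but is counted once.
hookLength : Partition → Box → ℕ
hookLength μ s = length (filter (inHook? s) (diagram μ))

-- By definition, divisibility in ℤ is divisibility of absolute values in ℕ.
ν : ℕ → ℤ → ℕ
ν ℓ k = if does (ℓ ∣? ∣ k ∣) then 1 else 0

Regular : ℕ → Partition → Set
Regular ℓ μ = ∀ k → 0 < k → length (filter (k ≟_) (parts μ)) < ℓ

Adjacent : Box → Box → Set
Adjacent (x , y) (x′ , y′) =
    (x ≡ x′ × (y′ ≡ suc y ⊎ y ≡ suc y′))
  ⊎ (y ≡ y′ × (x′ ≡ suc x ⊎ x ≡ suc x′))

-- RimHook ℓ μ R μ′: the boxes R form a removable ℓ-rim hook of μ, and removing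
-- them leaves the diagram of μ′.  Connectedness of the sequence R means that
-- consecutive boxes share an edge.
record RimHook (ℓ : ℕ) (μ : Partition) (R : List Box) (μ′ : Partition) : Set where
  field
    distinct  : Unique R
    size      : length R ≡ ℓ
    inside    : R ⊆ diagram μ
    connected : Linked Adjacent R
    no-square : ∀ x y → ¬ ((x , y) ∈ R × (x , suc y) ∈ R ×
                           (suc x , y) ∈ R × (suc x , suc y) ∈ R)
    remainder : ∀ s → s ∈ diagram μ′ ⇔ (s ∈ diagram μ × s ∉ R)

Horizontal : List Box → Set
Horizontal R = ∃[ r ] All (λ s → proj₁ s ≡ r) R

HasNonHorizontal : ℕ → Partition → Set
HasNonHorizontal ℓ μ = ∃[ R ] ∃[ μ′ ] (RimHook ℓ μ R μ′ × ¬ Horizontal R)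

RemoveHorizontal : ℕ → Partition → Partition → Set
RemoveHorizontal ℓ μ μ′ = ∃[ R ] (RimHook ℓ μ R μ′ × Horizontal R)

record ℓ-Partition (ℓ : ℕ) (μ : Partition) : Set where
  field
    regular           : Regular ℓ μ
    no-non-horizontal : ¬ HasNonHorizontal ℓ μ
    after-removal     : ∀ μ′ → Star (RemoveHorizontal ℓ) μ μ′ →
                        ¬ HasNonHorizontal ℓ μ′

{-# OPTIONS --safe #-}
-- A rim hook of ℓ boxes runs along the rim from the foot of a column c to the end of a row a, where
-- the box (a , c) has hook length ℓ; conversely, every box of hook length ℓ yields one.  It is
-- horizontal exactly when (a , c) is the foot of its column.  So a non-horizontal rim hook puts into
-- one column the hook length ℓ and, at the foot, a hook length strictly between 0 and ℓ.
--
-- Removing a horizontal ℓ-rim hook changes the hook lengths by multiples of ℓ, except in the columns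
-- that lose a box.  There the hook lengths above fall short by a constant of those in a column in which
-- all of them are divisible by ℓ.  Hence (★) survives horizontal removals, and it excludes ℓ equal
-- parts, which would have hook lengths 1 and ℓ in their last column.
--
-- Conversely, suppose that column c has a hook length divisible by ℓ in row a, and one not divisible
-- by ℓ in row b.  While the former exceeds ℓ, it can be reduced by ℓ: either a lower row has the
-- reduced hook length, or row a ends in a removable rim hook, which is horizontal or finishes the proof.
-- Once it equals ℓ, either it belongs to a non-horizontal rim hook, or a is the foot of the column;
-- then b is above a, the hook length of b exceeds ℓ and can be reduced in its turn.
module Submission where

open import Defs
open import Algebra.Properties.CommutativeSemigroup using (interchange)
open import Data.Fin using (Fin; zero; suc; toℕ; fromℕ<)
open import Data.Fin.Properties using (toℕ-injective; toℕ-fromℕ<)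
open import Data.Integer using (+_)
open import Data.List using (List; []; _∷_; _++_; length; map; filter; upTo; allFin)
import Data.List as List
open import Data.List.Membership.DecPropositional using (_∈?_)
open import Data.List.Membership.Propositional using (_∈_; find; lose)
open import Data.List.Membership.Propositional.Properties
open import Data.List.Membership.Propositional.Properties.WithK using (unique∧set⇒bag)
open import Data.List.Properties using (length-map; length-++; length-upTo; filter-accept; filter-reject)
open import Data.List.Relation.Binary.BagAndSetEquality using (∼bag⇒↭)
open import Data.List.Relation.Binary.Disjoint.Propositional using (Disjoint)
open import Data.List.Relation.Binary.Permutation.Propositional.Properties using (↭-length)
open import Data.List.Relation.Unary.All as All using (All; []; _∷_)
import Data.List.Relation.Unary.All.Properties as All
open import Data.List.Relation.Unary.AllPairs as AllPairs using ([]; _∷_)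
import Data.List.Relation.Unary.AllPairs.Properties as AllPairs
open import Data.List.Relation.Unary.Any using (here; there)
open import Data.List.Relation.Unary.Linked as Linked using (Linked; []; [-]; _∷_)
open import Data.List.Relation.Unary.Unique.Propositional using (Unique)
import Data.List.Relation.Unary.Unique.Propositional.Properties as Unique
open import Data.Maybe as Maybe using (Maybe; _<∣>_; from-just; From-just)
open import Data.Nat
open import Data.Nat.Divisibility
open import Data.Nat.Properties
open import Data.Product using (_×_; _,_; proj₁; proj₂; ∃-syntax)
open import Data.Product.Properties using (≡-dec; ,-injectiveˡ; ,-injectiveʳ)
open import Data.Sum using (_⊎_; inj₁; inj₂)
open import Data.Vec as Vec using (Vec; []; _∷_; lookup; zipWith; replicate; _[_]≔_)
open import Data.Vec.N-ary using (N-ary; _$ⁿ_)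
open import Data.Vec.Relation.Binary.Pointwise.Inductive as Pointwise using (Pointwise; []; _∷_)
open import Function using (_∘_; _$_; flip)
open import Function.Bundles using (_⇔_; mk⇔; Equivalence)
open import Relation.Binary.Construct.Closure.ReflexiveTransitive using (Star; ε; _◅_)
open import Relation.Binary.Definitions using (tri<; tri≈; tri>)
open import Relation.Binary.PropositionalEquality
open import Relation.Nullary using (Dec; ¬_; yes; no; contradiction)
open import Relation.Nullary.Decidable using (_×-dec_; dec⇒maybe; decidable-stable)
open import Relation.Unary using (Decidable)

-- Linear arithmetic

infixl 7 _:+_
infix 6 _:≤_ _:<_ _:≡_
infix 3 _⊢_

data Expr (n : ℕ) : Set where
  var  : Fin n → Expr n
  con  : ℕ → Expr n
  _:+_ : Expr n → Expr n → Expr n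

data Formula (n : ℕ) : Set where
  _:≤_ _:≡_ : Expr n → Expr n → Formula n

_:<_ : ∀ {n} → Expr n → Expr n → Formula n
x :< y = con 1 :+ x :≤ y

record Sequent (n : ℕ) : Set where
  constructor _⊢_
  field
    hypotheses : List (Formula n)
    goal       : Formula n

module _ {n : ℕ} where

  ⟦_⟧ : Expr n → Vec ℕ n → ℕ
  ⟦ var i ⟧  ρ = lookup ρ i
  ⟦ con k ⟧  ρ = k
  ⟦ x :+ y ⟧ ρ = ⟦ x ⟧ ρ + ⟦ y ⟧ ρ

  Holds : Formula n → Vec ℕ n → Set
  Holds (x :≤ y) ρ = ⟦ x ⟧ ρ ≤ ⟦ y ⟧ ρ
  Holds (x :≡ y) ρ = ⟦ x ⟧ ρ ≡ ⟦ y ⟧ ρ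

  Implies : List (Formula n) → Vec ℕ n → Set → Set
  Implies []       ρ G = G
  Implies (h ∷ hs) ρ G = Holds h ρ → Implies hs ρ G

  implies-map : ∀ hs {ρ G H} → (G → H) → Implies hs ρ G → Implies hs ρ H
  implies-map []       f p   = f p
  implies-map (h ∷ hs) f p q = implies-map hs f (p q)

  implies-map₂ : ∀ hs {ρ G H K} → (G → H → K) → Implies hs ρ G → Implies hs ρ H → Implies hs ρ K
  implies-map₂ []       f p q   = f p q
  implies-map₂ (h ∷ hs) f p q r = implies-map₂ hs f (p r) (q r)

+-interchange = interchange +-commutativeSemigroup

dot : ∀ {n} → Vec ℕ n → Vec ℕ n → ℕ
dot []       []       = 0
dot (k ∷ ks) (x ∷ xs) = k * x + dot ks xs

dot-0 : ∀ {n} (ρ : Vec ℕ n) → dot (replicate n 0) ρ ≡ 0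
dot-0 []      = refl
dot-0 (_ ∷ ρ) = dot-0 ρ

dot-unit : ∀ {n} (i : Fin n) ρ → dot (replicate n 0 [ i ]≔ 1) ρ ≡ lookup ρ i
dot-unit zero    (x ∷ ρ) = trans (cong₂ _+_ (*-identityˡ x) (dot-0 ρ)) (+-identityʳ x)
dot-unit (suc i) (_ ∷ ρ) = dot-unit i ρ

dot-+ : ∀ {n} (u v ρ : Vec ℕ n) → dot (zipWith _+_ u v) ρ ≡ dot u ρ + dot v ρ
dot-+ []       []       []      = refl
dot-+ (k ∷ u) (l ∷ v) (x ∷ ρ) =
  trans (cong₂ _+_ (*-distribʳ-+ x k l) (dot-+ u v ρ)) (+-interchange (k * x) (l * x) (dot u ρ) (dot v ρ))

dot-mono : ∀ {n} {u v : Vec ℕ n} → Pointwise _≤_ u v → ∀ ρ → dot u ρ ≤ dot v ρ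
dot-mono []       []      = z≤n
dot-mono (p ∷ ps) (x ∷ ρ) = +-mono-≤ (*-monoˡ-≤ x p) (dot-mono ps ρ)

module _ {n : ℕ} where

  coefficients : Expr n → ℕ × Vec ℕ n
  coefficients (var i)  = 0 , replicate n 0 [ i ]≔ 1
  coefficients (con k)  = k , replicate n 0
  coefficients (x :+ y) with coefficients x | coefficients y
  ... | k , u | l , v = k + l , zipWith _+_ u v

  value : ℕ × Vec ℕ n → Vec ℕ n → ℕ
  value (k , u) ρ = k + dot u ρ

  coefficients-correct : ∀ x ρ → value (coefficients x) ρ ≡ ⟦ x ⟧ ρ
  coefficients-correct (var i)  ρ = dot-unit i ρ
  coefficients-correct (con k)  ρ = trans (cong (λ z → k + z) (dot-0 ρ)) (+-identityʳ k)
  coefficients-correct (x :+ y) ρ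
    with coefficients x | coefficients y | coefficients-correct x ρ | coefficients-correct y ρ
  ... | k , u | l , v | p | q = trans (cong (λ z → k + l + z) (dot-+ u v ρ))
    (trans (+-interchange k l (dot u ρ) (dot v ρ)) (cong₂ _+_ p q))

  -- Variables range over ℕ, so comparing coefficients one by one is a sound test for `≤`.
  Dominated : Expr n → Expr n → Set
  Dominated x y = proj₁ (coefficients x) ≤ proj₁ (coefficients y)
                × Pointwise _≤_ (proj₂ (coefficients x)) (proj₂ (coefficients y))

  dominated? : ∀ x y → Dec (Dominated x y)
  dominated? x y = (_ ≤? _) ×-dec Pointwise.decidable _≤?_ _ _

  dominated⇒≤ : ∀ x y → Dominated x y → ∀ ρ → ⟦ x ⟧ ρ ≤ ⟦ y ⟧ ρ
  dominated⇒≤ x y (p , q) ρ = subst₂ _≤_ (coefficients-correct x ρ) (coefficients-correct y ρ)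
    (+-mono-≤ p (dot-mono q ρ))

  -- Read backwards, this spends a hypothesis `a ≤ b`: the goal `s ≤ t` is replaced by
  -- `s + b ≤ t + a`.
  cancel : ∀ {s t a b} → s + b ≤ t + a → a ≤ b → s ≤ t
  cancel {s} {t} {a} {b} p q = +-cancelʳ-≤ b s t (≤-trans p (+-monoʳ-≤ t q))

  -- The inequality has to follow by adding up hypotheses, each taken at most once.
  prove-≤ : ∀ hs (x y : Expr n) → Maybe (∀ ρ → Implies hs ρ (⟦ x ⟧ ρ ≤ ⟦ y ⟧ ρ))
  prove-≤ []             x y = Maybe.map (dominated⇒≤ x y) (dec⇒maybe (dominated? x y))
  prove-≤ (a :≤ b ∷ hs) x y =
        Maybe.map (λ p ρ h → implies-map hs (λ q → cancel q h) (p ρ)) (prove-≤ hs (x :+ b) (y :+ a))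
    <∣> Maybe.map (λ p ρ _ → p ρ) (prove-≤ hs x y)
  prove-≤ (a :≡ b ∷ hs) x y =
        Maybe.map (λ p ρ h → implies-map hs (λ q → cancel q (≤-reflexive h)) (p ρ))
                  (prove-≤ hs (x :+ b) (y :+ a))
    <∣> Maybe.map (λ p ρ h → implies-map hs (λ q → cancel q (≤-reflexive (sym h))) (p ρ))
                  (prove-≤ hs (x :+ a) (y :+ b))
    <∣> Maybe.map (λ p ρ _ → p ρ) (prove-≤ hs x y)

  prove : ∀ hs (g : Formula n) → Maybe (∀ ρ → Implies hs ρ (Holds g ρ))
  prove hs (x :≤ y) = prove-≤ hs x y
  prove hs (x :≡ y) = Maybe.zipWith (λ p q ρ → implies-map₂ hs ≤-antisym (p ρ) (q ρ))
                                    (prove-≤ hs x y) (prove-≤ hs y x)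

∀ᵛ : ∀ n → (Vec ℕ n → Set) → Set
∀ᵛ zero    P = P []
∀ᵛ (suc n) P = ∀ x → ∀ᵛ n (P ∘ (x ∷_))

∀ᵛ-intro : ∀ n {P : Vec ℕ n → Set} → (∀ ρ → P ρ) → ∀ᵛ n P
∀ᵛ-intro zero    p   = p []
∀ᵛ-intro (suc n) p x = ∀ᵛ-intro n (p ∘ (x ∷_))

abstract
  -- A reflective prover: `f` builds a sequent in `n` variables, and the type computes to its
  -- universal closure when the search succeeds. Inconsistent hypotheses are exploited with the goal
  -- `con 0 :< con 0`.
  linear : ∀ n (f : N-ary n (Expr n) (Sequent n)) →
    let hs ⊢ g = f $ⁿ Vec.map var (Vec.allFin n) in
    From-just (Maybe.map (∀ᵛ-intro n {λ ρ → Implies hs ρ (Holds g ρ)}) (prove hs g))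
  linear n f = let hs ⊢ g = f $ⁿ Vec.map var (Vec.allFin n) in
    from-just (Maybe.map (∀ᵛ-intro n {λ ρ → Implies hs ρ (Holds g ρ)}) (prove hs g))

-- Rows, columns and hook lengths

<⇔<⇒≡ : ∀ {m n} → (∀ i → i < m → i < n) → (∀ i → i < n → i < m) → m ≡ n
<⇔<⇒≡ f g = ≤-antisym (≮⇒≥ (n≮n _ ∘ f _)) (≮⇒≥ (n≮n _ ∘ g _))

unique∧set⇒length : ∀ {A : Set} {xs ys : List A} → Unique xs → Unique ys →
  (∀ {x} → x ∈ xs → x ∈ ys) → (∀ {x} → x ∈ ys → x ∈ xs) → length xs ≡ length ys
unique∧set⇒length u v f g = ↭-length (∼bag⇒↭ (unique∧set⇒bag u v (mk⇔ f g)))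

-- The default 0 makes row lengths a total function, so that `c < entry ps i` alone expresses that
-- `(i , c)` is a box.
entry : List ℕ → ℕ → ℕ
entry []       _       = 0
entry (p ∷ ps) zero    = p
entry (p ∷ ps) (suc i) = entry ps i

entry-lookup : ∀ ps (i : Fin (length ps)) → List.lookup ps i ≡ entry ps (toℕ i)
entry-lookup (p ∷ ps) zero    = refl
entry-lookup (p ∷ ps) (suc i) = entry-lookup ps i

entry-length : ∀ ps {i} → 0 < entry ps i → i < length ps
entry-length (p ∷ ps) {zero}  _ = z<s
entry-length (p ∷ ps) {suc i} q = s<s (entry-length ps q)

entry-antitone : ∀ {ps} → Linked _≥_ ps → ∀ i → entry ps (suc i) ≤ entry ps i
entry-antitone []      i       = z≤n
entry-antitone [-]     i       = z≤n
entry-antitone (q ∷ l) zero    = q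
entry-antitone (q ∷ l) (suc i) = entry-antitone l i

antitone⇒≥ : ∀ (f : ℕ → ℕ) → (∀ i → f (suc i) ≤ f i) → ∀ {i k} → i ≤ k → f k ≤ f i
antitone⇒≥ f p {i} i≤k with m≤n⇒∃[o]m+o≡n i≤k
... | o , refl = go o
  where
  go : ∀ o → f (i + o) ≤ f i
  go zero    = ≤-reflexive (cong f (+-identityʳ i))
  go (suc o) = ≤-trans (≤-reflexive (cong f (+-suc i o))) (≤-trans (p (i + o)) (go o))

-- For the parts of a partition this is the length of column `c`, a part of the conjugate partition.
#above : ℕ → List ℕ → ℕ
#above c ps = length (filter (c <?_) ps)

-- In a weakly decreasing list the entries exceeding `c` form an initial segment, so counting them
-- locates them.
#above⇒entry : ∀ {ps} → Linked _≥_ ps → ∀ {c} i → i < #above c ps → c < entry ps i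
entry⇒#above : ∀ {ps} → Linked _≥_ ps → ∀ {c} i → c < entry ps i → i < #above c ps

#above⇒entry {[]}     l i ()
#above⇒entry {p ∷ ps} l {c} i q with c <? p
#above⇒entry {p ∷ ps} l {c} zero q | yes c<p = c<p
#above⇒entry {p ∷ ps} l {c} (suc i) q | yes c<p rewrite filter-accept (c <?_) {xs = ps} c<p =
  #above⇒entry (Linked.tail l) i (s<s⁻¹ q)
#above⇒entry {p ∷ ps} l {c} i q | no c≮p rewrite filter-reject (c <?_) {xs = ps} c≮p = contradiction
  (<-≤-trans (#above⇒entry (Linked.tail l) i q)
    (antitone⇒≥ (entry (p ∷ ps)) (entry-antitone l) {0} {suc i} z≤n)) c≮p

entry⇒#above {[]}     l i ()
entry⇒#above {p ∷ ps} l {c} i q with c <? p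
entry⇒#above {p ∷ ps} l {c} zero q | yes c<p rewrite filter-accept (c <?_) {xs = ps} c<p = z<s
entry⇒#above {p ∷ ps} l {c} (suc i) q | yes c<p rewrite filter-accept (c <?_) {xs = ps} c<p =
  s<s (entry⇒#above (Linked.tail l) i q)
entry⇒#above {p ∷ ps} l {c} i q | no c≮p = contradiction
  (<-≤-trans q (antitone⇒≥ (entry (p ∷ ps)) (entry-antitone l) {0} {i} z≤n)) c≮p

module _ (μ : Partition) where

  row : ℕ → ℕ
  row = entry (parts μ)

  col : ℕ → ℕ
  col c = #above c (parts μ)

  row-suc : ∀ i → row (suc i) ≤ row i
  row-suc = entry-antitone (weakly-decreasing μ)

  row-antitone : ∀ {i k} → i ≤ k → row k ≤ row i
  row-antitone = antitone⇒≥ row row-suc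

  <col⇒<row : ∀ {i c} → i < col c → c < row i
  <col⇒<row = #above⇒entry (weakly-decreasing μ) _

  <row⇒<col : ∀ {i c} → c < row i → i < col c
  <row⇒<col = entry⇒#above (weakly-decreasing μ) _

  private
    rowBoxes : Fin (length (parts μ)) → List Box
    rowBoxes i = map (toℕ i ,_) (upTo (List.lookup (parts μ) i))

    rowBoxes-row : ∀ {x y} i → (x , y) ∈ rowBoxes i → x ≡ toℕ i
    rowBoxes-row i p with ∈-map⁻ (toℕ i ,_) p
    ... | _ , _ , refl = refl

  ∈-diagram⁻ : ∀ {x y} → (x , y) ∈ diagram μ → y < row x
  ∈-diagram⁻ p with find (∈-concatMap⁻ rowBoxes {xs = allFin _} p)
  ... | i , _ , q with ∈-map⁻ (toℕ i ,_) q
  ... | y , r , refl = subst (y <_) (entry-lookup (parts μ) i) (∈-upTo⁻ r)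

  ∈-diagram⁺ : ∀ {x y} → y < row x → (x , y) ∈ diagram μ
  ∈-diagram⁺ {x} {y} p = ∈-concatMap⁺ rowBoxes {xs = allFin _}
      (lose (∈-allFin i) (subst (λ z → (z , y) ∈ rowBoxes i) eq
        (∈-map⁺ (toℕ i ,_) (∈-upTo⁺ (subst (y <_)
          (sym (trans (entry-lookup (parts μ) i) (cong row eq))) p)))))
    where
    x<len = entry-length (parts μ) (≤-<-trans z≤n p)
    i     = fromℕ< x<len
    eq    = toℕ-fromℕ< x<len

  diagram-unique : Unique (diagram μ)
  diagram-unique = Unique.concat⁺
    (All.map⁺ (All.universal (λ i → Unique.map⁺ ,-injectiveʳ (Unique.upTo⁺ _)) (allFin _)))
    (AllPairs.map⁺ (AllPairs.map disjoint (Unique.allFin⁺ _)))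
    where
    disjoint : ∀ {i j} → i ≢ j → Disjoint (rowBoxes i) (rowBoxes j)
    disjoint {i} {j} i≢j (p , q) = i≢j (toℕ-injective (trans (sym (rowBoxes-row i p)) (rowBoxes-row j q)))

  private
    -- The corner belongs to the arm only, which makes the two lists disjoint.
    arm leg : ℕ → ℕ → List Box
    arm a c = map (λ k → a , c + k) (upTo (row a ∸ c))
    leg a c = map (λ k → suc a + k , c) (upTo (col c ∸ suc a))

    <∸⇒+< : ∀ {m n k} → m ≤ n → k < n ∸ m → m + k < n
    <∸⇒+< {m} {n} {k} m≤n p = subst (_< n) (+-comm k m) (m≤o∸n⇒m+n≤o (suc k) m≤n p)

    arm∪leg⊆hook : ∀ {a c s} → c < row a → s ∈ arm a c ++ leg a c →
                   s ∈ filter (inHook? (a , c)) (diagram μ)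
    arm∪leg⊆hook {a} {c} c<row p with ∈-++⁻ (arm a c) p
    ... | inj₁ q with ∈-map⁻ _ q
    ...   | k , r , refl = ∈-filter⁺ (inHook? (a , c)) (∈-diagram⁺ (<∸⇒+< (<⇒≤ c<row) (∈-upTo⁻ r)))
                             (inj₁ (refl , m≤m+n c k))
    arm∪leg⊆hook {a} {c} c<row p | inj₂ q with ∈-map⁻ _ q
    ...   | k , r , refl = ∈-filter⁺ (inHook? (a , c)) (∈-diagram⁺ (<col⇒<row (<∸⇒+< (<row⇒<col c<row) (∈-upTo⁻ r))))
                             (inj₂ (refl , m≤n⇒m≤1+n (m≤m+n a k)))

    in-arm : ∀ {a c y} → c ≤ y → y < row a → (a , y) ∈ arm a c
    in-arm {a} {c} c≤y y<row with m≤n⇒∃[o]m+o≡n c≤y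
    ... | k , refl = ∈-map⁺ _ (∈-upTo⁺ (subst (_≤ row a ∸ c) (m+n∸m≡n c (suc k))
                       (∸-monoˡ-≤ c (subst (_≤ row a) (sym (+-suc c k)) y<row))))

    in-leg : ∀ {a c x} → a < x → c < row x → (x , c) ∈ leg a c
    in-leg {a} {c} a<x c<row with m≤n⇒∃[o]m+o≡n a<x
    ... | k , refl = ∈-map⁺ _ (∈-upTo⁺ (subst (_≤ col c ∸ suc a) (m+n∸m≡n (suc a) (suc k))
                       (∸-monoˡ-≤ (suc a) (subst (_≤ col c) (sym (+-suc (suc a) k)) (<row⇒<col c<row)))))

    hook⊆arm∪leg : ∀ {a c s} → s ∈ filter (inHook? (a , c)) (diagram μ) → s ∈ arm a c ++ leg a c
    hook⊆arm∪leg {a} {c} {x , y} p with ∈-filter⁻ (inHook? (a , c)) {xs = diagram μ} p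
    ... | q , inj₁ (refl , c≤y) = ∈-++⁺ˡ (in-arm c≤y (∈-diagram⁻ q))
    ... | q , inj₂ (refl , a≤x) with a ≟ x
    ...   | yes refl = ∈-++⁺ˡ (in-arm ≤-refl (∈-diagram⁻ q))
    ...   | no  a≢x  = ∈-++⁺ʳ (arm a c) (in-leg (≤∧≢⇒< a≤x a≢x) (∈-diagram⁻ q))

    arm++leg-unique : ∀ a c → Unique (arm a c ++ leg a c)
    arm++leg-unique a c = Unique.++⁺
      (Unique.map⁺ (λ eq → +-cancelˡ-≡ c _ _ (,-injectiveʳ eq)) (Unique.upTo⁺ _))
      (Unique.map⁺ (λ eq → +-cancelˡ-≡ (suc a) _ _ (,-injectiveˡ eq)) (Unique.upTo⁺ _))
      disjoint
      where
      disjoint : ∀ {s} → ¬ (s ∈ arm a c × s ∈ leg a c)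
      disjoint (p , q) with ∈-map⁻ _ p | ∈-map⁻ _ q
      ... | _ , _ , refl | k , _ , eq = m≢1+m+n a (,-injectiveˡ eq)

  -- The arm has `row μ a − c` boxes and the leg `col μ c − a − 1`; moving the subtracted terms
  -- across avoids truncated subtraction.
  hookLength-formula : ∀ {a c} → c < row a → hookLength μ (a , c) + suc (a + c) ≡ row a + col c
  hookLength-formula {a} {c} c<row = linear 7
    (λ h m n a c r l → (h :≡ m :+ n) ∷ (m :+ c :≡ r) ∷ (n :+ (con 1 :+ a) :≡ l) ∷ []
                     ⊢ h :+ (con 1 :+ (a :+ c)) :≡ r :+ l)
    (hookLength μ (a , c)) (row a ∸ c) (col c ∸ suc a) a c (row a) (col c)
    length-hook (m∸n+n≡m (<⇒≤ c<row)) (m∸n+n≡m (<row⇒<col c<row))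
    where
    length-hook : hookLength μ (a , c) ≡ (row a ∸ c) + (col c ∸ suc a)
    length-hook = trans
      (unique∧set⇒length (Unique.filter⁺ (inHook? (a , c)) diagram-unique) (arm++leg-unique a c)
        hook⊆arm∪leg (arm∪leg⊆hook c<row))
      (trans (length-++ (arm a c)) (cong₂ _+_
        (trans (length-map _ (upTo (row a ∸ c))) (length-upTo (row a ∸ c)))
        (trans (length-map _ (upTo (col c ∸ suc a))) (length-upTo (col c ∸ suc a)))))

-- The list is cut at the first zero of `f`, after which monotonicity leaves only zeros; `n` bounds
-- the recursion.
fromRows : ∀ (f : ℕ → ℕ) n → (∀ i → f (suc i) ≤ f i) → f n ≡ 0 → ∃[ μ ] (∀ i → row μ i ≡ f i)
fromRows f n anti fn≡0 = record { parts = list f n ; weakly-decreasing = decreasing f n anti ; positive = pos f n }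
  , entries f n anti fn≡0
  where
  list : (ℕ → ℕ) → ℕ → List ℕ
  list f zero = []
  list f (suc n) with f 0
  ... | zero  = []
  ... | suc k = suc k ∷ list (f ∘ suc) n

  pos : ∀ f n → All (0 <_) (list f n)
  pos f zero = []
  pos f (suc n) with f 0
  ... | zero  = []
  ... | suc k = z<s ∷ pos (f ∘ suc) n

  entries : ∀ f n → (∀ i → f (suc i) ≤ f i) → f n ≡ 0 → ∀ i → entry (list f n) i ≡ f i
  entries f zero    anti eq i = sym (n≤0⇒n≡0 (subst (f i ≤_) eq (antitone⇒≥ f anti z≤n)))
  entries f (suc n) anti eq i with f 0 in eq₀
  entries f (suc n) anti eq i | zero = sym (n≤0⇒n≡0 (subst (f i ≤_) eq₀ (antitone⇒≥ f anti z≤n)))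
  entries f (suc n) anti eq zero | suc k = sym eq₀
  entries f (suc n) anti eq (suc i) | suc k = entries (f ∘ suc) n (anti ∘ suc) eq i

  decreasing : ∀ f n → (∀ i → f (suc i) ≤ f i) → Linked _≥_ (list f n)
  decreasing f zero anti = []
  decreasing f (suc n) anti with f 0 in eq₀
  ... | zero  = []
  ... | suc k with n
  ...   | zero = [-]
  ...   | suc m with f 1 in eq₁ | decreasing (f ∘ suc) (suc m) (anti ∘ suc)
  ...     | zero  | _ = [-]
  ...     | suc j | l = subst₂ _≥_ eq₀ eq₁ (anti 0) ∷ l

-- Removing the rim hook of a box

module _ (μ : Partition) where

  -- The second condition says that the diagonal neighbour `(suc i , suc j)` is not a box.
  Rim : ℕ → ℕ → Set
  Rim i j = j < row μ i × row μ (suc i) ≤ suc j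

  -- The content of the box (i , j) is j − i; the rim has one box of each content.
  rim-≮ : ∀ {i j x y} → Rim i j → Rim x y → y + i ≡ j + x → ¬ i < x
  rim-≮ {i} {j} {x} {y} (_ , p) (q , _) e i<x = n≮0 $
    linear 6 (λ i j x y m n → (m :≤ con 1 :+ j) ∷ (y :< n) ∷ (n :≤ m) ∷ (y :+ i :≡ j :+ x) ∷ (i :< x) ∷ []
                            ⊢ con 0 :< con 0)
      i j x y (row μ (suc i)) (row μ x) p q (row-antitone μ i<x) e i<x

  rim-content-injective : ∀ {i j x y} → Rim i j → Rim x y → y + i ≡ j + x → (i , j) ≡ (x , y)
  rim-content-injective {i} {j} {x} {y} p q e
    with refl ← ≤-antisym (≮⇒≥ (rim-≮ q p (sym e))) (≮⇒≥ (rim-≮ p q e))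
    with refl ← +-cancelʳ-≡ i y j e = refl

  -- Contents with subtraction cleared: `y − x ≤ j − i < y − x + n`.
  record InWalk (n x y i j : ℕ) : Set where
    constructor inWalk
    field
      rim : Rim i j
      low : y + i ≤ j + x
      high : j + x < y + i + n

  -- The n boxes of the rim whose contents are those of (x , y) and its n − 1 successors.
  record Walk (n x y : ℕ) : Set where
    field
      boxes    : List Box
      size     : length boxes ≡ n
      distinct : Unique boxes
      linked   : ∀ {p} → Adjacent p (x , y) → Linked Adjacent (p ∷ boxes)
      sound    : ∀ {i j} → (i , j) ∈ boxes → InWalk n x y i j
      complete : ∀ {i j} → InWalk n x y i j → (i , j) ∈ boxes

  stop : ∀ {x y} → Walk 0 x y
  stop = record
    { boxes = [] ; size = refl ; distinct = [] ; linked = λ _ → [-] ; sound = λ ()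
    ; complete = λ { {i} {j} (inWalk _ l h) →
        contradiction (≤-trans h (≤-trans (≤-reflexive (+-identityʳ _)) l)) (n≮n _) } }

  -- The equation says that the content grows by one. The longer interval of contents thus gains one
  -- content, and `(x , y)` is the only rim box that has it.
  step : ∀ {n x y x′ y′} → Rim x y → Adjacent (x , y) (x′ , y′) → y′ + x ≡ suc y + x′ →
         Walk n x′ y′ → Walk (suc n) x y
  step {n} {x} {y} {x′} {y′} r adj e w = record
    { boxes    = (x , y) ∷ boxes
    ; size     = cong suc size
    ; distinct = All.tabulate fresh ∷ distinct
    ; linked   = λ a → a ∷ linked adj
    ; sound    = sound′
    ; complete = complete′ }
    where
    open Walk w
    fresh : ∀ {s} → s ∈ boxes → (x , y) ≢ s
    fresh p refl = n≮0 $ linear 4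
      (λ x y x′ y′ → (y′ :+ x :≤ y :+ x′) ∷ (y′ :+ x :≡ con 1 :+ y :+ x′) ∷ [] ⊢ con 0 :< con 0)
      x y x′ y′ (InWalk.low (sound p)) e

    sound′ : ∀ {i j} → (i , j) ∈ (x , y) ∷ boxes → InWalk (suc n) x y i j
    sound′ (here refl) = inWalk r ≤-refl (m<m+n (y + x) z<s)
    sound′ {i} {j} (there p) with inWalk q l h ← sound p = inWalk q
      (linear 6 (λ i j x y x′ y′ → (y′ :+ i :≤ j :+ x′) ∷ (y′ :+ x :≡ con 1 :+ y :+ x′) ∷ []
                                 ⊢ y :+ i :≤ j :+ x) i j x y x′ y′ l e)
      (linear 7 (λ i j x y x′ y′ n → (j :+ x′ :< y′ :+ i :+ n) ∷ (y′ :+ x :≡ con 1 :+ y :+ x′) ∷ []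
                                 ⊢ j :+ x :< y :+ i :+ (con 1 :+ n)) i j x y x′ y′ n h e)

    complete′ : ∀ {i j} → InWalk (suc n) x y i j → (i , j) ∈ (x , y) ∷ boxes
    complete′ {i} {j} (inWalk q l h) with m≤n⇒m<n∨m≡n l
    ... | inj₂ eq = here (rim-content-injective q r eq)
    ... | inj₁ lt = there (complete (inWalk q
      (linear 6 (λ i j x y x′ y′ → (y :+ i :< j :+ x) ∷ (y′ :+ x :≡ con 1 :+ y :+ x′) ∷ []
                                 ⊢ y′ :+ i :≤ j :+ x′) i j x y x′ y′ lt e)
      (linear 7 (λ i j x y x′ y′ n → (j :+ x :< y :+ i :+ (con 1 :+ n)) ∷ (y′ :+ x :≡ con 1 :+ y :+ x′) ∷ []
                                 ⊢ j :+ x′ :< y′ :+ i :+ n) i j x y x′ y′ n h e)))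

  -- The walk goes up where it cannot go right; the bound keeps it from leaving the diagram in row 0.
  walk : ∀ a n x y → Rim x y → y + a + n ≤ row μ a + x → Walk n x y
  walk a zero    x y r b = stop
  walk a (suc n) x y r@(p , q) b with suc y <? row μ x
  ... | yes p′ = step r (inj₁ (refl , inj₁ refl)) refl (walk a n x (suc y) (p′ , m≤n⇒m≤1+n q)
    (linear 5 (λ x y a n r → (y :+ a :+ (con 1 :+ n) :≤ r :+ x) ∷ [] ⊢ con 1 :+ y :+ a :+ n :≤ r :+ x)
       x y a n (row μ a) b))
  walk a (suc n) (suc x) y r@(p , q) b | no ¬p′ =
    step r (inj₂ (refl , inj₂ refl)) (+-suc y x) (walk a n x y (<-≤-trans p (row-suc μ x) , ≮⇒≥ ¬p′)
    (linear 5 (λ x y a n r → (y :+ a :+ (con 1 :+ n) :≤ r :+ (con 1 :+ x)) ∷ [] ⊢ y :+ a :+ n :≤ r :+ x)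
       x y a n (row μ a) b))
  -- The walk may end with the last box of row 0: the empty walk `stop` may start outside the
  -- diagram.
  walk a (suc zero)    zero y r b | no ¬p′ = step r (inj₁ (refl , inj₁ refl)) refl stop
  walk a (suc (suc n)) zero y r b | no ¬p′ = contradiction
    (linear 5 (λ y a n r t → (y :+ a :+ (con 2 :+ n) :≤ r :+ con 0) ∷ (r :≤ t) ∷ (t :≤ con 1 :+ y) ∷ []
                           ⊢ con 0 :< con 0)
       y a n (row μ a) (row μ 0) b (row-antitone μ z≤n) (≮⇒≥ ¬p′)) n≮0

  -- Here `(s , c)` is the foot of column `c`, and `hook≡ℓ` says that `(a , c)` has hook length `ℓ`.
  module Removal {ℓ a s c : ℕ} (a≤s : a ≤ s) (c<row : c < row μ s) (row≤c : row μ (suc s) ≤ c)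
                 (hook≡ℓ : row μ a + s ≡ ℓ + (a + c)) where

    record InHookRim (i j : ℕ) : Set where
      constructor inHookRim
      field
        a≤i : a ≤ i
        i≤s : i ≤ s
        c≤j : c ≤ j
        rim : Rim i j

    hookRim⇒walk : ∀ {i j} → InHookRim i j → InWalk ℓ s c i j
    hookRim⇒walk {i} {j} (inHookRim a≤i i≤s c≤j r) = inWalk r (+-mono-≤ c≤j i≤s)
      (linear 8 (λ a s c ℓ i j ri ra → (j :< ri) ∷ (ri :≤ ra) ∷ (a :≤ i) ∷ (ra :+ s :≡ ℓ :+ (a :+ c)) ∷ []
                                     ⊢ j :+ s :< c :+ i :+ ℓ)
        a s c ℓ i j (row μ i) (row μ a) (proj₁ r) (row-antitone μ a≤i) a≤i hook≡ℓ)

    -- The contents in question run from `c − s`, at the foot, to `row μ a − 1 − a`, at the end of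
    -- row `a`. A rim box below row `s` has a smaller content, and one above row `a` a larger
    -- content.
    walk⇒hookRim : ∀ {i j} → InWalk ℓ s c i j → InHookRim i j
    walk⇒hookRim {i} {j} (inWalk r l h) = inHookRim a≤i i≤s c≤j r
      where
      i≤s : i ≤ s
      i≤s = ≮⇒≥ λ s<i → n≮0 $
        linear 6 (λ s c i j ri rs → (s :< i) ∷ (j :< ri) ∷ (ri :≤ rs) ∷ (rs :≤ c) ∷ (c :+ i :≤ j :+ s) ∷ []
                                  ⊢ con 0 :< con 0)
          s c i j (row μ i) (row μ (suc s)) s<i (proj₁ r) (row-antitone μ s<i) row≤c l
      a≤i : a ≤ i
      a≤i = ≮⇒≥ λ i<a → n≮0 $
        linear 8 (λ a s c ℓ i j ri ra → (i :< a) ∷ (ri :≤ con 1 :+ j) ∷ (ra :≤ ri) ∷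
                     (ra :+ s :≡ ℓ :+ (a :+ c)) ∷ (j :+ s :< c :+ i :+ ℓ) ∷ []
                                  ⊢ con 0 :< con 0)
          a s c ℓ i j (row μ (suc i)) (row μ a) i<a (proj₂ r) (row-antitone μ i<a) hook≡ℓ h
      c≤j : c ≤ j
      c≤j with m≤n⇒m<n∨m≡n i≤s
      ... | inj₂ refl = +-cancelʳ-≤ i c j l
      ... | inj₁ i<s  = s≤s⁻¹ (≤-trans c<row (≤-trans (row-antitone μ i<s) (proj₂ r)))

    hookWalk : Walk ℓ s c
    hookWalk = walk a ℓ s c (c<row , m≤n⇒m≤1+n row≤c)
      (linear 5 (λ a s c ℓ ra → (ra :+ s :≡ ℓ :+ (a :+ c)) ∷ [] ⊢ c :+ a :+ ℓ :≤ ra :+ s)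
        a s c ℓ (row μ a) hook≡ℓ)

    open Walk hookWalk public using (boxes; size; distinct; linked; sound; complete)

    boxes⇒hookRim : ∀ {i j} → (i , j) ∈ boxes → InHookRim i j
    boxes⇒hookRim = walk⇒hookRim ∘ sound

    hookRim⇒boxes : ∀ {i j} → InHookRim i j → (i , j) ∈ boxes
    hookRim⇒boxes = complete ∘ hookRim⇒walk

    -- A box (i , j) in rows a to s stays if j < c or if (suc i , suc j) is a box.
    remaining : ℕ → ℕ
    remaining i with (a ≤? i) ×-dec (i ≤? s)
    ... | yes _ = row μ i ⊓ (c ⊔ pred (row μ (suc i)))
    ... | no  _ = row μ i

    remaining⇒row : ∀ {i j} → j < remaining i → j < row μ i
    remaining⇒row {i} p with (a ≤? i) ×-dec (i ≤? s)
    ... | yes _ = m<n⊓o⇒m<n _ _ p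
    ... | no  _ = p

    remaining⇒¬hookRim : ∀ {i j} → j < remaining i → ¬ InHookRim i j
    remaining⇒¬hookRim {i} {j} p (inHookRim a≤i i≤s c≤j (_ , r)) with (a ≤? i) ×-dec (i ≤? s)
    ... | no ¬q = ¬q (a≤i , i≤s)
    ... | yes _ with ⊔-sel c (pred (row μ (suc i)))
    ...   | inj₁ eq = n≮n j (<-≤-trans (subst (j <_) eq (m<n⊓o⇒m<o _ _ p)) c≤j)
    ...   | inj₂ eq = n≮n _ (<-≤-trans (pred-cancel-< {suc j} (subst (j <_) eq (m<n⊓o⇒m<o _ _ p))) r)

    row⇒remaining : ∀ {i j} → j < row μ i → ¬ InHookRim i j → j < remaining i
    row⇒remaining {i} {j} p ¬r with (a ≤? i) ×-dec (i ≤? s)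
    ... | no  _ = p
    ... | yes (a≤i , i≤s) = ⊓-pres-m< p below
      where
      below : j < c ⊔ pred (row μ (suc i))
      below with c ≤? j | suc j <? row μ (suc i)
      ... | no  c≰j | _      = m<n⇒m<n⊔o _ (≰⇒> c≰j)
      ... | yes _   | yes q  = m<n⇒m<o⊔n c (suc[m]≤n⇒m≤pred[n] q)
      ... | yes c≤j | no ¬q  = contradiction (inHookRim a≤i i≤s c≤j (p , ≮⇒≥ ¬q)) ¬r

    -- A box above a remaining box remains. If `(i , j)` were in the rim hook, then either `i` is
    -- `s` and there is no box below it, or `(suc i , j)` would be in the rim hook too.
    remaining-antitone : ∀ i → remaining (suc i) ≤ remaining i
    remaining-antitone i = ≮⇒≥ λ lt →
      n≮n _ (row⇒remaining (<-≤-trans (remaining⇒row lt) (row-suc μ i)) (up lt))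
      where
      up : ∀ {j} → j < remaining (suc i) → ¬ InHookRim i j
      up {j} lt (inHookRim a≤i i≤s c≤j (_ , r)) with m≤n⇒m<n∨m≡n i≤s
      ... | inj₂ refl = n≮n j (<-≤-trans (remaining⇒row lt) (≤-trans row≤c c≤j))
      ... | inj₁ i<s  = remaining⇒¬hookRim lt
        (inHookRim (m≤n⇒m≤1+n a≤i) i<s c≤j (remaining⇒row lt , ≤-trans (row-suc μ (suc i)) r))

    remaining-length : remaining (length (parts μ)) ≡ 0
    remaining-length = n≤0⇒n≡0 (≮⇒≥ λ lt →
      n≮n _ (entry-length (parts μ) (remaining⇒row lt)))

    remainder-partition : ∃[ μ′ ] (∀ i → row μ′ i ≡ remaining i)
    remainder-partition = fromRows remaining _ remaining-antitone remaining-length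

    μ′ : Partition
    μ′ = proj₁ remainder-partition

    row-μ′ : ∀ i → row μ′ i ≡ remaining i
    row-μ′ = proj₂ remainder-partition

    rimHook : RimHook ℓ μ boxes μ′
    rimHook = record
      { distinct  = distinct
      ; size      = size
      ; inside    = λ p → ∈-diagram⁺ μ (proj₁ (InHookRim.rim (boxes⇒hookRim p)))
      -- `linked` needs some box in front; `(s , suc c)` is merely a neighbour of the first box and
      -- is dropped again.
      ; connected = Linked.tail (linked {s , suc c} (inj₁ (refl , inj₂ refl)))
      ; no-square = λ x y (p , _ , _ , q) → n≮n _ (<-≤-trans
          (proj₁ (InHookRim.rim (boxes⇒hookRim q))) (proj₂ (InHookRim.rim (boxes⇒hookRim p))))
      ; remainder = λ (x , y) → mk⇔
          (λ p → let q = subst (y <_) (row-μ′ x) (∈-diagram⁻ μ′ p) in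
            ∈-diagram⁺ μ (remaining⇒row q) , remaining⇒¬hookRim q ∘ boxes⇒hookRim)
          (λ (p , q) → ∈-diagram⁺ μ′ (subst (y <_) (sym (row-μ′ x))
            (row⇒remaining (∈-diagram⁻ μ p) (q ∘ hookRim⇒boxes)))) }

    corner : (s , c) ∈ boxes
    corner = hookRim⇒boxes (inHookRim a≤s ≤-refl ≤-refl (c<row , m≤n⇒m≤1+n row≤c))

    end : ∃[ d ] (a , d) ∈ boxes
    end with m≤n⇒∃[o]m+o≡n (<-≤-trans c<row (row-antitone μ a≤s))
    ... | o , eq = c + o , hookRim⇒boxes (inHookRim ≤-refl a≤s (m≤m+n c o)
                     (≤-reflexive eq , ≤-trans (row-suc μ a) (≤-reflexive (sym eq))))

    horizontal : a ≡ s → All (λ b → proj₁ b ≡ a) boxes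
    horizontal refl = All.tabulate λ p → let q = boxes⇒hookRim p in
      ≤-antisym (InHookRim.i≤s q) (InHookRim.a≤i q)

    non-horizontal : a < s → ¬ Horizontal boxes
    non-horizontal a<s (r , h) = <⇒≢ a<s
      (trans (All.lookup h (proj₂ end)) (sym (All.lookup h corner)))

-- The shape of a rim hook

data NorthEast : Box → Box → Set where
  right : ∀ {x y} → NorthEast (x , y) (x , suc y)
  up    : ∀ {x y} → NorthEast (suc x , y) (x , y)

adjacent⇒northEast : ∀ {p q} → Adjacent p q → NorthEast p q ⊎ NorthEast q p
adjacent⇒northEast (inj₁ (refl , inj₁ refl)) = inj₁ right
adjacent⇒northEast (inj₁ (refl , inj₂ refl)) = inj₂ right
adjacent⇒northEast (inj₂ (refl , inj₁ refl)) = inj₂ up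
adjacent⇒northEast (inj₂ (refl , inj₂ refl)) = inj₁ up

SameContent : Box → Box → Set
SameContent (x , y) (x′ , y′) = y + x′ ≡ y′ + x

sameContent⇒≡ : ∀ {x y x′ y′} → SameContent (x , y) (x′ , y′) → x ≡ x′ → (x , y) ≡ (x′ , y′)
sameContent⇒≡ {x} {y} {_} {y′} e refl = cong (x ,_) (+-cancelʳ-≡ x y y′ e)

northEast-content : ∀ {p q x y} → NorthEast p (x , y) → NorthEast q (x , y) → SameContent p q
northEast-content right       right       = refl
northEast-content (right {x} {y}) up      = +-suc y x
northEast-content up (right {x} {y})      = sym (+-suc y x)
northEast-content up          up          = refl

northEast-content′ : ∀ {p q x y} → NorthEast (x , y) p → NorthEast (x , y) q → SameContent p q
northEast-content′ right           right           = refl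
northEast-content′ (right {_} {y}) (up {x})        = sym (+-suc y x)
northEast-content′ (up {x})        (right {_} {y}) = +-suc y x
northEast-content′ up              up              = refl

ContentInjective : List Box → Set
ContentInjective R = ∀ {p q} → p ∈ R → q ∈ R → SameContent p q → p ≡ q

-- Every step changes the content by one, so turning round would repeat a content.
monotone : ∀ {R} → Unique R → ContentInjective R → Linked Adjacent R →
           Linked NorthEast R ⊎ Linked (flip NorthEast) R
monotone u inj []        = inj₁ []
monotone u inj [-]       = inj₁ [-]
monotone u inj (a ∷ [-]) with adjacent⇒northEast a
... | inj₁ ne = inj₁ (ne ∷ [-])
... | inj₂ sw = inj₂ (sw ∷ [-])
monotone ((_ ∷ p≢r ∷ _) ∷ u) inj (a ∷ l@(_ ∷ _))
  with adjacent⇒northEast a | monotone u (λ p q → inj (there p) (there q)) l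
... | inj₁ ne | inj₁ l′         = inj₁ (ne ∷ l′)
... | inj₂ sw | inj₂ l′         = inj₂ (sw ∷ l′)
... | inj₁ ne | inj₂ (sw ∷ _) = contradiction
  (inj (here refl) (there (there (here refl))) (northEast-content ne sw)) p≢r
... | inj₂ sw | inj₁ (ne ∷ _) = contradiction
  (inj (here refl) (there (there (here refl))) (northEast-content′ sw ne)) p≢r

record Between (p q b : Box) : Set where
  constructor between
  field
    north : proj₁ q ≤ proj₁ b
    south : proj₁ b ≤ proj₁ p
    west  : proj₂ p ≤ proj₂ b
    east  : proj₂ b ≤ proj₂ q

-- The field `size` says that `R` has as many boxes as there are contents from that of `p` to that
-- of `q`.
record Span (R : List Box) (p q : Box) : Set where
  field
    southWest∈ : p ∈ R
    northEast∈ : q ∈ R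
    bounds     : ∀ {b} → b ∈ R → Between p q b
    size       : suc (proj₂ q + proj₁ p) ≡ proj₂ p + proj₁ q + length R

span-[-] : ∀ b → Span (b ∷ []) b b
span-[-] (x , y) = record
  { southWest∈ = here refl
  ; northEast∈ = here refl
  ; bounds     = λ { (here refl) → between ≤-refl ≤-refl ≤-refl ≤-refl }
  ; size       = sym (+-comm (y + x) 1) }

extend-southWest : ∀ {b R p q} → NorthEast b p → Span R p q → Span (b ∷ R) b q
extend-southWest {b} {R} {p} {q} ne sp = record
  { southWest∈ = here refl
  ; northEast∈ = there northEast∈
  ; bounds     = λ { (here refl) → first ne (bounds northEast∈) (bounds southWest∈)
                   ; (there m) → widen ne (bounds m) }
  ; size       = grow ne size }
  where
  open Span sp
  widen : ∀ {b p s} → NorthEast b p → Between p q s → Between b q s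
  widen right (between n s w e) = between n s (<⇒≤ w) e
  widen up    (between n s w e) = between n (m≤n⇒m≤1+n s) w e
  first : ∀ {b p} → NorthEast b p → Between p q q → Between p q p → Between b q b
  first right (between _ _ w _) (between n _ _ _) = between n ≤-refl ≤-refl (<⇒≤ w)
  first up    (between _ _ w _) (between n _ _ _) = between (m≤n⇒m≤1+n n) ≤-refl ≤-refl w
  grow : ∀ {b p l} → NorthEast b p → suc (proj₂ q + proj₁ p) ≡ proj₂ p + proj₁ q + l →
         suc (proj₂ q + proj₁ b) ≡ proj₂ b + proj₁ q + suc l
  grow {l = l} (right {x} {y}) e = trans e (sym (+-suc (y + proj₁ q) l))
  grow {l = l} (up {x} {y})    e =
    trans (cong suc (+-suc (proj₂ q) x)) (trans (cong suc e) (sym (+-suc (y + proj₁ q) l)))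

extend-northEast : ∀ {b R p q} → NorthEast q b → Span R p q → Span (b ∷ R) p b
extend-northEast {b} {R} {p} {q} ne sp = record
  { southWest∈ = there southWest∈
  ; northEast∈ = here refl
  ; bounds     = λ { (here refl) → last ne (bounds northEast∈) (bounds southWest∈)
                   ; (there m) → widen ne (bounds m) }
  ; size       = grow ne size }
  where
  open Span sp
  widen : ∀ {b q s} → NorthEast q b → Between p q s → Between p b s
  widen right (between n s w e) = between n s w (m≤n⇒m≤1+n e)
  widen up    (between n s w e) = between (<⇒≤ n) s w e
  last : ∀ {b q} → NorthEast q b → Between p q q → Between p q p → Between p b b
  last right (between _ s w _) _ = between ≤-refl s (m≤n⇒m≤1+n w) ≤-refl
  last up    (between _ s w _) _ = between ≤-refl (<⇒≤ s) w ≤-refl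
  grow : ∀ {b q l} → NorthEast q b → suc (proj₂ q + proj₁ p) ≡ proj₂ p + proj₁ q + l →
         suc (proj₂ b + proj₁ p) ≡ proj₂ p + proj₁ b + suc l
  grow {l = l} (right {x} {y}) e = trans (cong suc e) (sym (+-suc (proj₂ p + x) l))
  grow {l = l} (up {x} {y})    e = trans e
    (trans (cong (_+ l) (+-suc (proj₂ p) x)) (sym (+-suc (proj₂ p + x) l)))

northEast⇒span : ∀ {b R} → Linked NorthEast (b ∷ R) → ∃[ q ] Span (b ∷ R) b q
northEast⇒span [-]      = _ , span-[-] _
northEast⇒span (ne ∷ l) = let q , sp = northEast⇒span l in q , extend-southWest ne sp

southWest⇒span : ∀ {b R} → Linked (flip NorthEast) (b ∷ R) → ∃[ p ] Span (b ∷ R) p b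
southWest⇒span [-]      = _ , span-[-] _
southWest⇒span (ne ∷ l) = let p , sp = southWest⇒span l in p , extend-northEast ne sp

monotone⇒span : ∀ {R} → 0 < length R → Linked NorthEast R ⊎ Linked (flip NorthEast) R →
                ∃[ p ] ∃[ q ] Span R p q
monotone⇒span {b ∷ R} _ (inj₁ l) = b , northEast⇒span l
monotone⇒span {b ∷ R} _ (inj₂ l) = let p , sp = southWest⇒span l in p , b , sp

module _ {ℓ μ R μ′} (h : RimHook ℓ μ R μ′) where
  open RimHook h

  removed⁻ : ∀ {x y} → (x , y) ∈ R → y < row μ x × row μ′ x ≤ y
  removed⁻ p = ∈-diagram⁻ μ (inside p) ,
    ≮⇒≥ λ lt → proj₂ (Equivalence.to (remainder _) (∈-diagram⁺ μ′ lt)) p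

  removed⁺ : ∀ {x y} → y < row μ x → row μ′ x ≤ y → (x , y) ∈ R
  removed⁺ {x} {y} p q = decidable-stable (_∈?_ (≡-dec _≟_ _≟_) (x , y) R) λ ∉R →
    <⇒≱ (∈-diagram⁻ μ′ (Equivalence.from (remainder _) (∈-diagram⁺ μ p , ∉R))) q

  remainder-row≤ : ∀ i → row μ′ i ≤ row μ i
  remainder-row≤ i = ≮⇒≥ λ lt →
    n≮n _ (∈-diagram⁻ μ (proj₁ (Equivalence.to (remainder _) (∈-diagram⁺ μ′ lt))))

  -- With a second removed box further down the diagonal, the 2×2 square at `(x , y)` lies in the
  -- diagram of `μ`. It avoids `μ′` because its upper left corner does, so it lies in `R`.
  removed-content-≮ : ∀ {x y x′ y′} → (x , y) ∈ R → (x′ , y′) ∈ R → y + x′ ≡ y′ + x → ¬ x < x′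
  removed-content-≮ {x} {y} {x′} {y′} p q e x<x′ = no-square x y
      (p , removed⁺ (<-≤-trans sy<row (row-suc μ x)) (m≤n⇒m≤1+n row′≤)
         , removed⁺ (<⇒≤ sy<row) row′s≤ , removed⁺ sy<row (m≤n⇒m≤1+n row′s≤))
    where
    row′≤  = proj₂ (removed⁻ p)
    row′s≤ = ≤-trans (row-suc μ′ x) row′≤
    sy<row : suc y < row μ (suc x)
    sy<row = linear 6 (λ x y x′ y′ r s → (x :< x′) ∷ (y :+ x′ :≡ y′ :+ x) ∷ (y′ :< r) ∷ (r :≤ s) ∷ []
                                       ⊢ con 1 :+ y :< s)
      x y x′ y′ (row μ x′) (row μ (suc x)) x<x′ e (proj₁ (removed⁻ q)) (row-antitone μ x<x′)

  removed-content-injective : ContentInjective R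
  removed-content-injective {x , y} {x′ , y′} p q e
    = sameContent⇒≡ e (≤-antisym (≮⇒≥ (removed-content-≮ q p (sym e))) (≮⇒≥ (removed-content-≮ p q e)))

  span : 0 < ℓ → ∃[ p ] ∃[ q ] Span R p q
  span 0<ℓ = monotone⇒span (subst (0 <_) (sym size) 0<ℓ)
    (monotone distinct removed-content-injective connected)

  record HookOf (t s c : ℕ) : Set where
    field
      t≤s   : t ≤ s
      c<row : c < row μ s
      row≤c : row μ (suc s) ≤ c
      hook  : row μ t + s ≡ ℓ + (t + c)
      rows  : ∀ {b} → b ∈ R → t ≤ proj₁ b × proj₁ b ≤ s
      c≤    : ∀ {b} → b ∈ R → c ≤ proj₂ b
      corner : (s , c) ∈ R
      top    : ∃[ d ] (t , d) ∈ R

  -- The south-west end is the foot of its column and the north-east end the end of its row: a box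
  -- of `μ` just below the former or just right of the latter would be removed as well, outside the
  -- bounds of the span. Counting contents then gives `hook`.
  hookOf : 0 < ℓ → ∃[ t ] ∃[ s ] ∃[ c ] HookOf t s c
  hookOf 0<ℓ with (s , c) , (t , d) , sp ← span 0<ℓ = t , s , c , record
    { t≤s   = Between.north (Span.bounds sp southWest∈)
    ; c<row = proj₁ (removed⁻ southWest∈)
    ; row≤c = ≮⇒≥ λ lt → n≮n s (Between.south (bounds
        (removed⁺ lt (≤-trans (row-suc μ′ s) (proj₂ (removed⁻ southWest∈))))))
    ; hook  = linear 6 (λ s c t d ℓ r → (r :≡ con 1 :+ d) ∷ (con 1 :+ (d :+ s) :≡ c :+ t :+ ℓ) ∷ []
                                       ⊢ r :+ s :≡ ℓ :+ (t :+ c))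
                s c t d ℓ (row μ t) row≡ (trans (Span.size sp) (cong (λ z → c + t + z) size))
    ; rows  = λ p → Between.north (bounds p) , Between.south (bounds p)
    ; c≤    = λ p → Between.west (bounds p)
    ; corner = southWest∈
    ; top    = d , northEast∈ }
    where
    open Span sp hiding (size)
    row≡ : row μ t ≡ suc d
    row≡ = ≤-antisym
      (≮⇒≥ λ lt → n≮n d (Between.east (bounds (removed⁺ lt (m≤n⇒m≤1+n (proj₂ (removed⁻ northEast∈)))))))
      (proj₁ (removed⁻ northEast∈))

-- Horizontal removal as the shortening of a row

record RowShortened (ℓ : ℕ) (μ : Partition) (r : ℕ) (μ′ : Partition) : Set where
  field
    shortened : row μ r ≡ ℓ + row μ′ r
    unchanged : ∀ {i} → i ≢ r → row μ′ i ≡ row μ i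

horizontal⇒rowShortened : ∀ {ℓ μ R μ′ r} → 0 < ℓ → RimHook ℓ μ R μ′ → All (λ b → proj₁ b ≡ r) R →
                          RowShortened ℓ μ r μ′
horizontal⇒rowShortened {ℓ} {μ} {R} {μ′} {r} 0<ℓ h all≡r with hookOf h 0<ℓ
... | t , s , c , k with refl ← All.lookup all≡r (HookOf.corner k) = record
  { shortened = linear 6 (λ t s c ℓ m n → (t :≡ s) ∷ (m :+ s :≡ ℓ :+ (t :+ c)) ∷ (n :≡ c) ∷ [] ⊢ m :≡ ℓ :+ n)
      t s c ℓ (row μ s) (row μ′ s) t≡s (subst (λ t′ → row μ t′ + s ≡ ℓ + (t + c)) t≡s hook) row′≡c
  ; unchanged = λ {i} i≢r → ≤-antisym (remainder-row≤ h i)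
      (≮⇒≥ λ lt → i≢r (All.lookup all≡r (removed⁺ h lt ≤-refl))) }
  where
  open HookOf k
  t≡s : t ≡ s
  t≡s = All.lookup all≡r (proj₂ top)
  row′≡c : row μ′ s ≡ c
  row′≡c = ≤-antisym (proj₂ (removed⁻ h corner)) (≮⇒≥ λ lt →
    n≮n _ (<-≤-trans lt (c≤ (removed⁺ h (<-trans lt c<row) ≤-refl))))

-- Uniform divisibility of hook lengths

module _ (μ : Partition) where

  col-≡ : ∀ {n c} → (∀ {i} → i < n → c < row μ i) → row μ n ≤ c → col μ c ≡ n
  col-≡ {n} p q = <⇔<⇒≡
    (λ i i<col → ≰⇒> λ n≤i → n≮n _ (<-≤-trans (<col⇒<row μ i<col) (≤-trans (row-antitone μ n≤i) q)))
    (λ i i<n → <row⇒<col μ (p i<n))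

  col-suc : ∀ {s c} → c < row μ s → row μ (suc s) ≤ c → col μ c ≡ suc s
  col-suc p = col-≡ (λ i≤s → <-≤-trans p (row-antitone μ (s≤s⁻¹ i≤s)))

  col≤ : ∀ {i c} → row μ i ≤ c → col μ c ≤ i
  col≤ p = ≮⇒≥ λ lt → n≮n _ (<-≤-trans (<col⇒<row μ lt) p)

  row≤ : ∀ {i c} → col μ c ≤ i → row μ i ≤ c
  row≤ p = ≮⇒≥ λ lt → n≮n _ (<-≤-trans (<row⇒<col μ lt) p)

  hookLength-positive : ∀ {a c} → c < row μ a → 0 < hookLength μ (a , c)
  hookLength-positive {a} {c} p =
    linear 5 (λ h a c r l → (h :+ (con 1 :+ (a :+ c)) :≡ r :+ l) ∷ (c :< r) ∷ (a :< l) ∷ [] ⊢ con 0 :< h)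
      (hookLength μ (a , c)) a c (row μ a) (col μ c) (hookLength-formula μ p) p (<row⇒<col μ p)

  -- `hookLength-formula` with the column length `suc s` read off from the foot `(s , c)`.
  hookLength-foot : ∀ {t s c} → t ≤ s → c < row μ s → row μ (suc s) ≤ c →
                    hookLength μ (t , c) + (t + c) ≡ row μ t + s
  hookLength-foot {t} {s} {c} t≤s p q =
    linear 6 (λ h t s c r l → (h :+ (con 1 :+ (t :+ c)) :≡ r :+ l) ∷ (l :≡ con 1 :+ s) ∷ []
                            ⊢ h :+ (t :+ c) :≡ r :+ s)
      (hookLength μ (t , c)) t s c (row μ t) (col μ c)
      (hookLength-formula μ (<-≤-trans p (row-antitone μ t≤s))) (col-suc p q)

-- This is (★) in terms of divisibility; one implication suffices, since `a` and `b` may be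
-- exchanged.
Uniform : ℕ → Partition → Set
Uniform ℓ μ = ∀ {a b c} → c < row μ a → c < row μ b →
              ℓ ∣ hookLength μ (a , c) → ℓ ∣ hookLength μ (b , c)

module _ {ℓ μ r μ′} (sh : RowShortened ℓ μ r μ′) where
  open RowShortened sh

  row-≤ : ∀ i → row μ′ i ≤ row μ i
  row-≤ i with i ≟ r
  ... | yes refl = ≤-trans (m≤n+m _ ℓ) (≤-reflexive (sym shortened))
  ... | no  i≢r  = ≤-reflexive (unchanged i≢r)

  -- `outside` says that column `c` loses no box: it lies to the left or to the right of the removed
  -- strip.
  module _ {c} (outside : c < row μ r → c < row μ′ r) where

    unshortened : ∀ {i} → c < row μ i → c < row μ′ i
    unshortened {i} p with i ≟ r
    ... | yes refl = outside p
    ... | no  i≢r  = subst (c <_) (sym (unchanged i≢r)) p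

    col-unchanged : col μ′ c ≡ col μ c
    col-unchanged = <⇔<⇒≡
      (λ i p → <row⇒<col μ (<-≤-trans (<col⇒<row μ′ p) (row-≤ i)))
      (λ i p → <row⇒<col μ′ (unshortened (<col⇒<row μ p)))

    hookLength-unchanged : ∀ {i} → i ≢ r → c < row μ′ i → hookLength μ′ (i , c) ≡ hookLength μ (i , c)
    hookLength-unchanged {i} i≢r p = +-cancelʳ-≡ (suc (i + c)) _ _
      (trans (hookLength-formula μ′ p) (trans (cong₂ _+_ (unchanged i≢r) col-unchanged)
        (sym (hookLength-formula μ (<-≤-trans p (row-≤ i))))))

    hookLength-shortened : c < row μ′ r → hookLength μ (r , c) ≡ ℓ + hookLength μ′ (r , c)
    hookLength-shortened p = linear 8
      (λ h h′ k m m′ l l′ ℓ → (h :+ k :≡ m :+ l) ∷ (h′ :+ k :≡ m′ :+ l′) ∷ (m :≡ ℓ :+ m′) ∷ (l′ :≡ l) ∷ []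
                            ⊢ h :≡ ℓ :+ h′)
      (hookLength μ (r , c)) (hookLength μ′ (r , c)) (suc (r + c)) (row μ r) (row μ′ r) (col μ c) (col μ′ c) ℓ
      (hookLength-formula μ (<-≤-trans p (row-≤ r))) (hookLength-formula μ′ p) shortened col-unchanged

    ∣hook⇔ : ∀ {i} → c < row μ′ i → ℓ ∣ hookLength μ′ (i , c) ⇔ ℓ ∣ hookLength μ (i , c)
    ∣hook⇔ {i} p with i ≟ r
    ... | yes refl = mk⇔ (λ d → subst (ℓ ∣_) (sym (hookLength-shortened p)) (∣m∣n⇒∣m+n ∣-refl d))
                         (λ d → ∣m+n∣m⇒∣n (subst (ℓ ∣_) (hookLength-shortened p) d) ∣-refl)
    ... | no  i≢r  = mk⇔ (subst (ℓ ∣_) (hookLength-unchanged i≢r p))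
                         (subst (ℓ ∣_) (sym (hookLength-unchanged i≢r p)))

  -- In the columns that lose their lowest box, the new hook lengths fall short of the old ones in
  -- column row μ′ r, all divisible by ℓ, by an amount depending on the column only.
  hookLength-above : ∀ {i k} → row μ′ r + k < row μ r → row μ′ r + k < row μ′ i →
                     hookLength μ (i , row μ′ r) ≡ hookLength μ′ (i , row μ′ r + k) + suc k
  hookLength-above {i} {k} p q = linear 7
    (λ h h′ i c k m r → (h :+ (i :+ c) :≡ m :+ r) ∷ (h′ :+ (con 1 :+ (i :+ (c :+ k))) :≡ m :+ r) ∷ []
                      ⊢ h :≡ h′ :+ (con 1 :+ k))
    (hookLength μ (i , row μ′ r)) (hookLength μ′ (i , row μ′ r + k)) i (row μ′ r) k (row μ i) r
    (hookLength-foot μ (<⇒≤ i<r) c<row row≤c)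
    (trans (hookLength-formula μ′ q) (cong₂ _+_ (unchanged (<⇒≢ i<r)) col≡))
    where
    i<r : i < r
    i<r = ≰⇒> λ r≤i → n≮n _ (<-≤-trans q (≤-trans (row-antitone μ′ r≤i) (m≤m+n _ k)))
    c<row : row μ′ r < row μ r
    c<row = ≤-<-trans (m≤m+n _ k) p
    row≤c : row μ (suc r) ≤ row μ′ r
    row≤c = ≤-trans (≤-reflexive (sym (unchanged (λ ())))) (row-suc μ′ r)
    col≡ : col μ′ (row μ′ r + k) ≡ r
    col≡ = col-≡ μ′ (λ j<r → subst (_ <_) (sym (unchanged (<⇒≢ j<r)))
      (<-≤-trans p (row-antitone μ (<⇒≤ j<r)))) (m≤m+n _ k)

  uniform-shortened : Uniform ℓ μ → Uniform ℓ μ′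
  uniform-shortened u {a} {b} {c} p q d with c <? row μ′ r | c <? row μ r
  ... | yes c< | _ = Equivalence.from (∣hook⇔ (λ _ → c<) q)
    (u (<-≤-trans p (row-≤ a)) (<-≤-trans q (row-≤ b)) (Equivalence.to (∣hook⇔ (λ _ → c<) p) d))
  ... | no _ | no c≮ = Equivalence.from (∣hook⇔ (λ lt → contradiction lt c≮) q)
    (u (<-≤-trans p (row-≤ a)) (<-≤-trans q (row-≤ b)) (Equivalence.to (∣hook⇔ (λ lt → contradiction lt c≮) p) d))
  ... | no c≮ | yes c< with m≤n⇒∃[o]m+o≡n (≮⇒≥ c≮)
  -- The first removed box has hook length `ℓ`, so `u` makes `ℓ` divide the whole column `row μ′ r`
  -- of `μ`, that is, new hook length plus `suc k` in each row. Row `a` then yields `ℓ ∣ suc k`, and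
  -- this settles row `b`.
  ...   | k , refl = ∣m+n∣n⇒∣m′ (divides-above q) (∣m+n∣m⇒∣n (divides-above p) d)
    where
    ∣m+n∣n⇒∣m′ : ∀ {m n} → ℓ ∣ m + n → ℓ ∣ n → ℓ ∣ m
    ∣m+n∣n⇒∣m′ {m} {n} e = ∣m+n∣m⇒∣n (subst (ℓ ∣_) (+-comm m n) e)
    hook≡ℓ : hookLength μ (r , row μ′ r) ≡ ℓ
    hook≡ℓ = linear 5 (λ h r m m′ ℓ → (h :+ (r :+ m′) :≡ m :+ r) ∷ (m :≡ ℓ :+ m′) ∷ [] ⊢ h :≡ ℓ)
      (hookLength μ (r , row μ′ r)) r (row μ r) (row μ′ r) ℓ
      (hookLength-foot μ ≤-refl (≤-<-trans (m≤m+n _ k) c<)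
        (≤-trans (≤-reflexive (sym (unchanged (λ ())))) (row-suc μ′ r)))
      shortened
    divides-above : ∀ {i} → row μ′ r + k < row μ′ i → ℓ ∣ hookLength μ′ (i , row μ′ r + k) + suc k
    divides-above {i} lt = subst (ℓ ∣_) (hookLength-above c< lt)
      (u (≤-<-trans (m≤m+n _ k) c<) (<-≤-trans (≤-<-trans (m≤m+n _ k) lt) (row-≤ i))
        (∣-reflexive (sym hook≡ℓ)))

-- Uniform partitions are ℓ-partitions

uniform⇒horizontal : ∀ {ℓ} μ → 0 < ℓ → Uniform ℓ μ → ¬ HasNonHorizontal ℓ μ
uniform⇒horizontal {ℓ} μ 0<ℓ u (R , μ′ , h , ¬hor) with hookOf h 0<ℓ
... | t , s , c , k = ¬hor (s , All.tabulate λ p → let t≤ , ≤s = rows p in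
        ≤-antisym ≤s (≤-trans (≮⇒≥ t≮s) t≤))
  where
  open HookOf k
  hook≡ℓ : hookLength μ (t , c) ≡ ℓ
  hook≡ℓ = +-cancelʳ-≡ (t + c) _ _ (trans (hookLength-foot μ t≤s c<row row≤c) hook)
  t≮s : ¬ t < s
  t≮s t<s = <⇒≱
    (linear 7 (λ t s c ℓ h rt rs → (h :+ (s :+ c) :≡ rs :+ s) ∷ (rs :≤ rt) ∷ (rt :+ s :≡ ℓ :+ (t :+ c)) ∷
                   (t :< s) ∷ [] ⊢ h :< ℓ)
      t s c ℓ (hookLength μ (s , c)) (row μ t) (row μ s)
      (hookLength-foot μ ≤-refl c<row row≤c) (row-antitone μ t≤s) hook t<s)
    (∣⇒≤ {{>-nonZero (hookLength-positive μ c<row)}}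
      (u (<-≤-trans c<row (row-antitone μ t≤s)) c<row (∣-reflexive (sym hook≡ℓ))))

uniform-preserved : ∀ {ℓ μ μ′} → 0 < ℓ → Uniform ℓ μ → Star (RemoveHorizontal ℓ) μ μ′ → Uniform ℓ μ′
uniform-preserved 0<ℓ u ε = u
uniform-preserved 0<ℓ u ((R , h , r , all≡r) ◅ rs) = uniform-preserved 0<ℓ
  (uniform-shortened (horizontal⇒rowShortened 0<ℓ h all≡r) u) rs

-- This expresses the multiplicity of a part as the difference of two consecutive column lengths.
count-equal : ∀ c ps → length (filter (suc c ≟_) ps) + #above (suc c) ps ≡ #above c ps
count-equal c [] = refl
count-equal c (p ∷ ps) with <-cmp p (suc c)
... | tri< p<k p≢k p≯k
  rewrite filter-reject (suc c ≟_) {xs = ps} (p≢k ∘ sym) | filter-reject (suc c <?_) {xs = ps} p≯k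
        | filter-reject (c <?_) {xs = ps} (≤⇒≯ (s≤s⁻¹ p<k)) = count-equal c ps
... | tri≈ p≮k refl p≯k
  rewrite filter-accept (suc c ≟_) {xs = ps} refl | filter-reject (suc c <?_) {xs = ps} p≯k
        | filter-accept (c <?_) {xs = ps} (n<1+n c) = cong suc (count-equal c ps)
... | tri> p≮k p≢k p>k
  rewrite filter-reject (suc c ≟_) {xs = ps} (p≢k ∘ sym) | filter-accept (suc c <?_) {xs = ps} p>k
        | filter-accept (c <?_) {xs = ps} (<⇒≤ p>k) = trans (+-suc _ _) (cong suc (count-equal c ps))

-- Let `s` be the last row of column `c` and `t` the row `ℓ − 1` above it. If `ℓ` parts equal
-- `suc c`, both rows end in column `c`, with hook lengths 1 and `ℓ`.
uniform⇒regular : ∀ {ℓ} μ → 2 ≤ ℓ → Uniform ℓ μ → Regular ℓ μ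
uniform⇒regular {ℓ} μ 2≤ℓ u (suc c) _ = ≰⇒> many
  where
  many : ¬ ℓ ≤ length (filter (suc c ≟_) (parts μ))
  many ℓ≤ with m≤n⇒∃[o]m+o≡n (≤-trans ℓ≤ (≤-trans (m≤m+n _ _) (≤-reflexive (count-equal c (parts μ)))))
  ... | t , ℓ+t≡col = <⇒≱ 2≤ℓ (∣⇒≤ (subst (ℓ ∣_) hook-s (u c<row-t c<row-s (∣-reflexive (sym hook-t)))))
    where
    s = pred (ℓ + t)
    suc-s : suc s ≡ ℓ + t
    suc-s = suc-pred (ℓ + t) {{>-nonZero (<-≤-trans (<⇒≤ 2≤ℓ) (m≤m+n ℓ t))}}
    t≤s : t ≤ s
    t≤s = linear 3 (λ s t ℓ → (con 2 :≤ ℓ) ∷ (con 1 :+ s :≡ ℓ :+ t) ∷ [] ⊢ t :≤ s) s t ℓ 2≤ℓ suc-s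
    c<row-s : c < row μ s
    c<row-s = <col⇒<row μ (≤-reflexive (trans suc-s ℓ+t≡col))
    c<row-t : c < row μ t
    c<row-t = <-≤-trans c<row-s (row-antitone μ t≤s)
    row≤c : row μ (suc s) ≤ c
    row≤c = row≤ μ (≤-reflexive (sym (trans suc-s ℓ+t≡col)))
    row-t≤ : row μ t ≤ suc c
    row-t≤ = row≤ μ (linear 5 (λ n l l′ t ℓ → (n :+ l :≡ l′) ∷ (ℓ :≤ n) ∷ (ℓ :+ t :≡ l′) ∷ [] ⊢ l :≤ t)
      (length (filter (suc c ≟_) (parts μ))) (col μ (suc c)) (col μ c) t ℓ
      (count-equal c (parts μ)) ℓ≤ ℓ+t≡col)
    row-t : row μ t ≡ suc c
    row-t = ≤-antisym row-t≤ c<row-t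
    row-s : row μ s ≡ suc c
    row-s = ≤-antisym (≤-trans (row-antitone μ t≤s) row-t≤) c<row-s
    hook-t : hookLength μ (t , c) ≡ ℓ
    hook-t = linear 6 (λ h t s c ℓ r → (h :+ (t :+ c) :≡ r :+ s) ∷ (r :≡ con 1 :+ c) ∷ (con 1 :+ s :≡ ℓ :+ t) ∷ []
                                     ⊢ h :≡ ℓ)
      (hookLength μ (t , c)) t s c ℓ (row μ t) (hookLength-foot μ t≤s c<row-s row≤c) row-t suc-s
    hook-s : hookLength μ (s , c) ≡ 1
    hook-s = linear 4 (λ h s c r → (h :+ (s :+ c) :≡ r :+ s) ∷ (r :≡ con 1 :+ c) ∷ [] ⊢ h :≡ con 1)
      (hookLength μ (s , c)) s c (row μ s) (hookLength-foot μ ≤-refl c<row-s row≤c) row-s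

uniform⇒ℓ-partition : ∀ {ℓ} μ → 2 ≤ ℓ → Uniform ℓ μ → ℓ-Partition ℓ μ
uniform⇒ℓ-partition {ℓ} μ 2≤ℓ u = record
  { regular           = uniform⇒regular μ 2≤ℓ u
  ; no-non-horizontal = uniform⇒horizontal μ 0<ℓ u
  ; after-removal     = λ μ′ rs → uniform⇒horizontal μ′ 0<ℓ (uniform-preserved 0<ℓ u rs) }
  where
  0<ℓ : 0 < ℓ
  0<ℓ = <⇒≤ 2≤ℓ

-- Reaching a non-horizontal rim hook

crossing : ∀ {P : ℕ → Set} → Decidable P → ∀ i o → ¬ P i → P (i + o) →
           ∃[ k ] (i ≤ k × ¬ P k × P (suc k))
crossing {P} P? i zero    ¬p p = contradiction (subst P (+-identityʳ i) p) ¬p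
crossing {P} P? i (suc o) ¬p p with P? (i + o)
... | yes q = crossing P? i o ¬p q
... | no ¬q = i + o , m≤m+n i o , ¬q , subst P (+-suc i o) p

module _ {ℓ : ℕ} {μ : Partition} where

  -- On the abacus with the beads row μ i − i, the place ℓ below a bead holds a bead or is empty;
  -- the empty places are those of the columns.
  data PlaceBelow (i : ℕ) : Set where
    bead : ∀ k → row μ k + (i + ℓ) ≡ row μ i + k → PlaceBelow i
    gap  : ∀ {s c} → i ≤ s → c < row μ s → row μ (suc s) ≤ c → row μ i + s ≡ ℓ + (i + c) → PlaceBelow i

  -- The beads `row μ k − k` decrease strictly: bead `i` is above the place `row μ i − i − ℓ`, bead
  -- `i + ℓ` is not. Where they cross, the next bead is either on the place or beyond it.
  placeBelow : 0 < ℓ → ∀ i → PlaceBelow i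
  placeBelow 0<ℓ i with crossing (λ k → row μ k + (i + ℓ) ≤? row μ i + k) i ℓ
    (<⇒≱ (+-monoʳ-< (row μ i) (m<m+n i 0<ℓ)))
    (+-monoˡ-≤ (i + ℓ) (row-antitone μ (m≤m+n i ℓ)))
  ... | k , i≤k , above , below with m≤n⇒m<n∨m≡n below
  ...   | inj₂ eq = bead (suc k) eq
  -- The place is strictly between the beads `k` and `suc k`. Its column `c` solves
  -- `c − k = row μ i − i − ℓ` and has its foot in row `k`.
  ...   | inj₁ lt with m≤n⇒∃[o]m+o≡n {i + ℓ} {row μ i + k}
    (linear 5 (λ i k ℓ r s → (s :+ (i :+ ℓ) :< r :+ (con 1 :+ k)) ∷ [] ⊢ i :+ ℓ :≤ r :+ k)
      i k ℓ (row μ i) (row μ (suc k)) lt)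
  ...     | c , e = gap i≤k
    (linear 6 (λ i k ℓ r s c → (r :+ k :< s :+ (i :+ ℓ)) ∷ (i :+ ℓ :+ c :≡ r :+ k) ∷ [] ⊢ c :< s)
      i k ℓ (row μ i) (row μ k) c (≰⇒> above) e)
    (linear 6 (λ i k ℓ r s c → (s :+ (i :+ ℓ) :< r :+ (con 1 :+ k)) ∷ (i :+ ℓ :+ c :≡ r :+ k) ∷ [] ⊢ s :≤ c)
      i k ℓ (row μ i) (row μ (suc k)) c lt e)
    (linear 5 (λ i k ℓ r c → (i :+ ℓ :+ c :≡ r :+ k) ∷ [] ⊢ r :+ k :≡ ℓ :+ (i :+ c)) i k ℓ (row μ i) c e)

  abstract
    nonHorizontal-removal : ∀ {a s c} → a < s → c < row μ s → row μ (suc s) ≤ c →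
                            row μ a + s ≡ ℓ + (a + c) → HasNonHorizontal ℓ μ
    nonHorizontal-removal a<s p q e = boxes , μ′ , rimHook , non-horizontal a<s
      where open Removal μ {ℓ} (<⇒≤ a<s) p q e

    horizontal-removal : ∀ {a c} → 0 < ℓ → c < row μ a → row μ (suc a) ≤ c → row μ a + a ≡ ℓ + (a + c) →
      ∃[ μ′ ] (RemoveHorizontal ℓ μ μ′ × RowShortened ℓ μ a μ′)
    horizontal-removal {a} 0<ℓ p q e =
      μ′ , (boxes , rimHook , a , horizontal refl) , horizontal⇒rowShortened 0<ℓ rimHook (horizontal refl)
      where open Removal μ {ℓ} ≤-refl p q e

  -- Both `lowerRow` and `remove` lower a hook length in column `c` by `ℓ`, by passing to another
  -- row or by shortening row `i` itself.
  data Shorter (i c : ℕ) : Set where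
    nonHorizontal : HasNonHorizontal ℓ μ → Shorter i c
    lowerRow : ∀ {k} → c < row μ k → hookLength μ (i , c) ≡ ℓ + hookLength μ (k , c) → Shorter i c
    remove   : ∀ {μ′} → RemoveHorizontal ℓ μ μ′ → RowShortened ℓ μ i μ′ → c < row μ′ i → Shorter i c

  shorten : ∀ {i c} → 0 < ℓ → c < row μ i → ℓ < hookLength μ (i , c) → Shorter i c
  shorten {i} {c} 0<ℓ c<row ℓ<h with placeBelow 0<ℓ i
  ... | bead k eq = lowerRow c<row-k
    (linear 9 (λ h h′ i k c ℓ r s l → (h :+ (con 1 :+ (i :+ c)) :≡ r :+ l) ∷
                 (h′ :+ (con 1 :+ (k :+ c)) :≡ s :+ l) ∷ (s :+ (i :+ ℓ) :≡ r :+ k) ∷ [] ⊢ h :≡ ℓ :+ h′)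
      (hookLength μ (i , c)) (hookLength μ (k , c)) i k c ℓ (row μ i) (row μ k) (col μ c)
      (hookLength-formula μ c<row) (hookLength-formula μ c<row-k) eq)
    where
    c<row-k : c < row μ k
    -- If row `k` did not reach column `c`, the hook length of `(i , c)` would be less than `ℓ`.
    c<row-k = ≰⇒> λ row≤c → n≮0 $
      linear 8 (λ h i k c ℓ r s l → (h :+ (con 1 :+ (i :+ c)) :≡ r :+ l) ∷ (l :≤ k) ∷
                   (s :+ (i :+ ℓ) :≡ r :+ k) ∷ (s :≤ c) ∷ (ℓ :< h) ∷ [] ⊢ con 0 :< con 0)
        (hookLength μ (i , c)) i k c ℓ (row μ i) (row μ k) (col μ c)
        (hookLength-formula μ c<row) (col≤ μ row≤c) eq row≤c ℓ<h
  ... | gap i≤s p q e with m≤n⇒m<n∨m≡n i≤s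
  ...   | inj₁ i<s  = nonHorizontal (nonHorizontal-removal i<s p q e)
  ...   | inj₂ refl with horizontal-removal 0<ℓ p q e
  -- If the removal took the box `(i , c)`, this box would be the foot of its column, with hook
  -- length at most `ℓ`.
  ...     | μ′ , rem , sh = remove rem sh (≰⇒> λ row≤c → n≮0 $
    linear 7 (λ h i c ℓ r s l → (h :+ (con 1 :+ (i :+ c)) :≡ r :+ l) ∷ (l :≤ con 1 :+ i) ∷
                 (r :≡ ℓ :+ s) ∷ (s :≤ c) ∷ (ℓ :< h) ∷ [] ⊢ con 0 :< con 0)
      (hookLength μ (i , c)) i c ℓ (row μ i) (row μ′ i) (col μ c)
      (hookLength-formula μ c<row)
      (col≤ μ (≤-trans (≤-reflexive (sym (RowShortened.unchanged sh λ ()))) (≤-trans (row-suc μ′ i) row≤c)))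
      (RowShortened.shortened sh) row≤c ℓ<h)

-- In the column of a gap x with a bead congruent to x above it, bring that bead down to x + ℓ, and
-- then any incongruent bead as far as it goes: it ends above x + ℓ, and moving it on passes x + ℓ.
reach-nonHorizontal : ∀ {ℓ} → 0 < ℓ → ∀ n {μ a b c} → c < row μ a → c < row μ b →
  ℓ ∣ hookLength μ (a , c) → ¬ ℓ ∣ hookLength μ (b , c) → hookLength μ (a , c) + hookLength μ (b , c) < n →
  ∃[ μ′ ] (Star (RemoveHorizontal ℓ) μ μ′ × HasNonHorizontal ℓ μ′)
reach-nonHorizontal {ℓ} 0<ℓ (suc n) {μ} {a} {b} {c} p q ℓ∣a ℓ∤b lt = go
  where
  ha = hookLength μ (a , c)
  hb = hookLength μ (b , c)
  a≢b : a ≢ b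
  a≢b refl = ℓ∤b ℓ∣a

  -- The recursion is on the bound `n` for the sum of the two hook lengths; each move lowers one of
  -- them by `ℓ` and keeps the other.
  decrease : ∀ {m m′ k} → m ≡ ℓ + m′ → m + k < suc n → m′ + k < n
  decrease {m} {m′} {k} e lt = linear 5
    (λ m m′ k n ℓ → (m :≡ ℓ :+ m′) ∷ (m :+ k :< con 1 :+ n) ∷ (con 0 :< ℓ) ∷ [] ⊢ m′ :+ k :< n)
    m m′ k n ℓ e lt 0<ℓ

  shorten-a : Shorter {ℓ} {μ} a c → ∃[ μ′ ] (Star (RemoveHorizontal ℓ) μ μ′ × HasNonHorizontal ℓ μ′)
  shorten-a (nonHorizontal nh) = μ , ε , nh
  shorten-a (lowerRow p′ e) = reach-nonHorizontal 0<ℓ n p′ q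
    (∣m+n∣m⇒∣n (subst (ℓ ∣_) e ℓ∣a) ∣-refl) ℓ∤b (decrease e lt)
  shorten-a (remove {μ′} rem sh p′) =
    let q′ = unshortened sh (λ _ → p′) q
        b≡ = hookLength-unchanged sh (λ _ → p′) (a≢b ∘ sym) q′
        ν , rems , nh = reach-nonHorizontal 0<ℓ n p′ q′
          (Equivalence.from (∣hook⇔ sh (λ _ → p′) p′) ℓ∣a)
          (ℓ∤b ∘ Equivalence.to (∣hook⇔ sh (λ _ → p′) q′))
          (subst (λ k → hookLength μ′ (a , c) + k < n) (sym b≡) (decrease (hookLength-shortened sh (λ _ → p′) p′) lt))
    in ν , rem ◅ rems , nh

  shorten-b : Shorter {ℓ} {μ} b c → ∃[ μ′ ] (Star (RemoveHorizontal ℓ) μ μ′ × HasNonHorizontal ℓ μ′)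
  shorten-b (nonHorizontal nh) = μ , ε , nh
  shorten-b (lowerRow q′ e) = reach-nonHorizontal 0<ℓ n p q′
    ℓ∣a (λ d → ℓ∤b (subst (ℓ ∣_) (sym e) (∣m∣n⇒∣m+n ∣-refl d)))
    (subst (_< n) (+-comm _ ha) (decrease e (subst (_< suc n) (+-comm ha hb) lt)))
  shorten-b (remove {μ′} rem sh q′) =
    let p′ = unshortened sh (λ _ → q′) p
        a≡ = hookLength-unchanged sh (λ _ → q′) a≢b p′
        ν , rems , nh = reach-nonHorizontal 0<ℓ n p′ q′
          (Equivalence.from (∣hook⇔ sh (λ _ → q′) p′) ℓ∣a)
          (ℓ∤b ∘ Equivalence.to (∣hook⇔ sh (λ _ → q′) q′))
          (subst (_< n) (trans (+-comm _ ha) (cong (_+ hookLength μ′ (b , c)) (sym a≡)))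
            (decrease (hookLength-shortened sh (λ _ → q′) q′) (subst (_< suc n) (+-comm ha hb) lt)))
    in ν , rem ◅ rems , nh

  go : ∃[ μ′ ] (Star (RemoveHorizontal ℓ) μ μ′ × HasNonHorizontal ℓ μ′)
  go with ℓ <? ha
  ... | yes ℓ<ha = shorten-a (shorten 0<ℓ p ℓ<ha)
  ... | no  ℓ≮ha with ≤-antisym (≮⇒≥ ℓ≮ha) (∣⇒≤ {{>-nonZero (hookLength-positive μ p)}} ℓ∣a)
                    | m≤n⇒∃[o]m+o≡n (<row⇒<col μ p)
  -- Column `c` continues below row `a` to its foot in row `a + suc o`, so the rim hook of `(a , c)`
  -- meets several rows.
  ...   | ha≡ℓ | suc o , e = μ , ε , nonHorizontal-removal (m<m+n a z<s) c<row row≤c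
    (trans (sym (hookLength-foot μ (m≤m+n a (suc o)) c<row row≤c)) (cong (_+ (a + c)) ha≡ℓ))
    where
    c<row : c < row μ (a + suc o)
    c<row = <col⇒<row μ (≤-reflexive e)
    row≤c : row μ (suc (a + suc o)) ≤ c
    row≤c = row≤ μ (≤-reflexive (sym e))
  ...   | ha≡ℓ | zero , e = shorten-b (shorten 0<ℓ q
    (linear 9 (λ h h′ a b c ℓ r s l → (h :+ (con 1 :+ (a :+ c)) :≡ r :+ l) ∷ (h′ :+ (con 1 :+ (b :+ c)) :≡ s :+ l) ∷
                 (h :≡ ℓ) ∷ (b :< a) ∷ (r :≤ s) ∷ [] ⊢ ℓ :< h′)
      ha hb a b c ℓ (row μ a) (row μ b) (col μ c)
      (hookLength-formula μ p) (hookLength-formula μ q) ha≡ℓ b<a (row-antitone μ (<⇒≤ b<a))))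
    where
    b<a : b < a
    b<a = ≤∧≢⇒< (s≤s⁻¹ (subst (b <_) (trans (sym e) (cong suc (+-identityʳ a))) (<row⇒<col μ q))) (a≢b ∘ sym)

ℓ-partition⇒uniform : ∀ {ℓ μ} → 0 < ℓ → ℓ-Partition ℓ μ → Uniform ℓ μ
ℓ-partition⇒uniform 0<ℓ π p q ℓ∣a = decidable-stable (_ ∣? _) λ ℓ∤b →
  let μ′ , rems , nh = reach-nonHorizontal 0<ℓ _ p q ℓ∣a ℓ∤b (n<1+n _)
  in ℓ-Partition.after-removal π μ′ rems nh

-- Divisibility and the indicator `ν`

ν-≡ : ∀ {ℓ m n} → (ℓ ∣ m → ℓ ∣ n) → (ℓ ∣ n → ℓ ∣ m) → ν ℓ (+ m) ≡ ν ℓ (+ n)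
ν-≡ {ℓ} {m} {n} f g with ℓ ∣? m | ℓ ∣? n
... | yes _ | yes _ = refl
... | no  _ | no  _ = refl
... | yes d | no ¬e = contradiction (f d) ¬e
... | no ¬d | yes e = contradiction (g e) ¬d

ν-≡⇒∣ : ∀ {ℓ m n} → ν ℓ (+ m) ≡ ν ℓ (+ n) → ℓ ∣ m → ℓ ∣ n
ν-≡⇒∣ {ℓ} {m} {n} eq d with ℓ ∣? m | ℓ ∣? n
... | _     | yes e = e
... | no ¬d | no _  = contradiction d ¬d

theorem2p2p1p6 : (ℓ : ℕ) → 2 ≤ ℓ → (μ : Partition) →
    ℓ-Partition ℓ μ ⇔
    (∀ a b c → (a , c) ∈ diagram μ → (b , c) ∈ diagram μ →
    ν ℓ (+ hookLength μ (a , c)) ≡ ν ℓ (+ hookLength μ (b , c)))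
theorem2p2p1p6 ℓ 2≤ℓ μ = mk⇔
  (λ π a b c p q → let u = ℓ-partition⇒uniform (<⇒≤ 2≤ℓ) π
                       p′ = ∈-diagram⁻ μ p
                       q′ = ∈-diagram⁻ μ q in ν-≡ (u p′ q′) (u q′ p′))
  (λ ★ → uniform⇒ℓ-partition μ 2≤ℓ (λ p q → ν-≡⇒∣ (★ _ _ _ (∈-diagram⁺ μ p) (∈-diagram⁺ μ q))))
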